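{- Let $a,b,n$ be positive integers with $1\le a<b$, and let $G$ be a finite simple graph with minimum degree $\delta(G)\geq a+n$ and isolated toughness $I(G)\geq a-1+n+\frac{a-1}{b}$. Then for every $n$-element subset $V'\subset V(G)$, the graph $G-V'$ has an $[a,b]$-factor.
   Context: For a graph $G$ and $S\subseteq V(G)$, $i(G-S)$ denotes the number of isolated vertices of $G-S$. The isolated toughness of $G$ is $I(G)=\min\{|S|/i(G-S): S\subseteq V(G),\ i(G-S)\geq 2\}$ if $G$ is not complete, and $I(G)=|V(G)|-1$ if $G$ is complete. A spanning subgraph $H$ of $G$ is an $[a,b]$-factor if $a\le d_H(x)\le b$ for every $x\in V(G)$. -}

module Defs where

open import Data.Nat using (ℕ; zero; suc; _+_; _*_; _∸_; _≤_; _<_; s≤s; z≤n; >-nonZero)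
open import Data.Nat.Properties using (≤-trans; n≤1+n)
open import Data.Integer using (ℤ; +_)
open import Data.Rational.Unnormalised using (ℚᵘ; _/_) renaming (_≤_ to _≤ℚ_; _+_ to _+ℚ_)
open import Data.Fin using (Fin)
open import Data.Fin.Subset using (Subset; _∈_; _∉_; ∣_∣; inside; outside)
open import Data.Fin.Subset.Properties using (_∈?_)
open import Data.Fin.Properties using (all?)
open import Data.Vec using (tabulate)
open import Data.Product using (Σ; _×_)
open import Relation.Nullary using (¬_; does; _→-dec_)
open import Relation.Binary.PropositionalEquality using (_≡_; _≢_)
open import Data.Bool using (if_then_else_)

record Graph (N : ℕ) : Set where
  field
    adj     : Fin N → Subset N
    irrefl  : ∀ v → v ∉ adj v
    sym     : ∀ u v → u ∈ adj v → v ∈ adj u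

open Graph public

degree : ∀ {N} → Graph N → Fin N → ℕ
degree G v = ∣ adj G v ∣

MinDegreeAtLeast : ∀ {N} → Graph N → ℕ → Set
MinDegreeAtLeast G d = ∀ v → d ≤ degree G v

Complete : ∀ {N} → Graph N → Set
Complete {N} G = ∀ (u v : Fin N) → u ≢ v → u ∈ adj G v

IsolatedIn : ∀ {N} → Graph N → Subset N → Fin N → Set
IsolatedIn {N} G S v = v ∉ S × (∀ (u : Fin N) → u ∈ adj G v → u ∈ S)

isolatedSet : ∀ {N} → Graph N → Subset N → Subset N
isolatedSet {N} G S = tabulate λ v →
  if does (v ∈? S) then outside
  else (if does (all? (λ u → (u ∈? adj G v) →-dec (u ∈? S))) then inside else outside)

iso : ∀ {N} → Graph N → Subset N → ℕ
iso G S = ∣ isolatedSet G S ∣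

ratio : (s i : ℕ) → 2 ≤ i → ℚᵘ
ratio s i h = _/_ (+ s) i {{>-nonZero (≤-trans (n≤1+n 1) h)}}

-- I(G) ≥ t, unfolding I(G) = min{|S|/i(G-S) : i(G-S) ≥ 2} (G not complete),
-- and I(G) = |V(G)| - 1 (G complete).
IsolToughnessAtLeast : ∀ {N} → Graph N → ℚᵘ → Set
IsolToughnessAtLeast {N} G t =
  (Complete G → t ≤ℚ (+ (N ∸ 1) / 1)) ×
  (¬ Complete G → ∀ (S : Subset N) (h : 2 ≤ iso G S) → t ≤ℚ ratio ∣ S ∣ (iso G S) h)

-- H is an [a,b]-factor of G - V': a spanning subgraph of G - V' (on vertex
-- set Fin N ∖ V', edges of G avoiding V') with a ≤ d_H(x) ≤ b for x ∉ V'.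
IsFactorOfDeletion : ∀ {N} → Graph N → Subset N → ℕ → ℕ → Graph N → Set
IsFactorOfDeletion {N} G V' a b H =
  (∀ u v → u ∈ adj H v → u ∈ adj G v) ×
  (∀ u v → u ∈ adj H v → u ∉ V') ×
  (∀ v → v ∉ V' → a ≤ degree H v × degree H v ≤ b)

HasFactorOfDeletion : ∀ {N} → Graph N → Subset N → ℕ → ℕ → Set
HasFactorOfDeletion {N} G V' a b = Σ (Graph N) λ H → IsFactorOfDeletion G V' a b H

{-# OPTIONS --safe #-}
module Submission where

-- The heart is Lovász's (g,f)-factor theorem for g < f: a subgraph F with all
-- degrees at most f and a vertex x of degree below g can be improved along an
-- alternating path from x, unless the vertices O reached by an edge outside F
-- and the vertices E reached by an edge of F satisfy
--   Σ_{O} f + Σ_{v ∈ E} d_{G-O}(v) < Σ_{E} g.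
-- With f = b and g = a on G - V', such a pair leaves, among the vertices of E of
-- degree d < a in G - V' - O, an independent set I (chosen greedily by least
-- degree, each choice discarding at most d + 1 vertices) with
-- b|O| < Σ_{I} (d + 1)(a - d). If |I| ≤ 1 this contradicts the minimum degree; if
-- |I| ≥ 2, deleting V', O and the neighbours of I isolates I, and the resulting
-- lower bound on |O| given by the isolated toughness is too large.

open import Defs hiding (sym)
open import Data.Bool using (Bool; true; false; not; _∧_; _∨_; _xor_; if_then_else_)
import Data.Bool as Bool
open import Data.Bool.Properties using (xor-identityʳ; ∨-comm; ∧-comm; ∨-zeroʳ; ∧-zeroʳ; ¬-not; T-≡)
open import Data.Fin using (Fin; zero; suc)
import Data.Fin as Fin
open import Data.Fin.Properties using (any?; all?)
open import Data.Fin.Subset using (Subset; ∣_∣; _∈_; _∉_; inside; outside)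
open import Data.Fin.Subset.Properties using (_∈?_)
open import Data.Integer using (+_)
import Data.Integer as ℤ
import Data.Integer.Properties as ℤ
open import Data.Nat using (ℕ; zero; suc; _+_; _*_; _∸_; _≤_; _<_; z≤n; s≤s; _<?_; _≤?_; NonZero)
open import Data.Nat.Properties
open import Algebra.Properties.Semiring.Sum +-*-semiring
  using (sum; sum-cong-≗; ∑-distrib-+; ∑-comm; *-distribˡ-sum; *-distribʳ-sum)
open import Data.Nat.Tactic.RingSolver using (solve-∀)
open import Data.Product using (∃; _×_; _,_; proj₁; proj₂)
open import Data.Rational.Unnormalised using (_/_) renaming (_≤_ to _≤ℚ_; _+_ to _+ℚ_)
open import Data.Rational.Unnormalised.Properties using (drop-*≤*)
open import Data.Sum using (_⊎_; inj₁; inj₂; [_,_]′)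
open import Data.Vec using ([]; _∷_)
import Data.Vec as Vec
open import Data.Vec.Properties using (lookup∘tabulate; []=⇒lookup; lookup⇒[]=)
open import Function using (_∘′_)
open import Function.Bundles using (Equivalence)
open import Relation.Binary.PropositionalEquality
open import Relation.Nullary using (¬_; Dec; does; yes; no; contradiction; _×-dec_; _⊎-dec_; _→-dec_)
open import Relation.Nullary.Decidable using (dec-true; dec-false)

-- Finite sums over vertex sets given as Boolean predicates.

𝟙 : Bool → ℕ
𝟙 true  = 1
𝟙 false = 0

size : ∀ {N} → (Fin N → Bool) → ℕ
size S = sum λ u → 𝟙 (S u)

∑∈ : ∀ {N} → (Fin N → Bool) → (Fin N → ℕ) → ℕ
∑∈ S w = sum λ u → 𝟙 (S u) * w u

sum-mono-≤ : ∀ {n} {s t : Fin n → ℕ} → (∀ i → s i ≤ t i) → sum s ≤ sum t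
sum-mono-≤ {zero}  s≤t = z≤n
sum-mono-≤ {suc n} s≤t = +-mono-≤ (s≤t zero) (sum-mono-≤ λ i → s≤t (suc i))

sum-mono-< : ∀ {n} {s t : Fin n → ℕ} → (∀ i → s i ≤ t i) → (j : Fin n) → s j < t j → sum s < sum t
sum-mono-< s≤t zero    sj<tj = +-mono-<-≤ sj<tj (sum-mono-≤ λ i → s≤t (suc i))
sum-mono-< s≤t (suc j) sj<tj = +-mono-≤-< (s≤t zero) (sum-mono-< (λ i → s≤t (suc i)) j sj<tj)

sum-zero : ∀ {n} → sum {n} (λ _ → 0) ≡ 0
sum-zero {zero}  = refl
sum-zero {suc n} = sum-zero {n}

infix 5 _==_
_==_ : ∀ {n} → Fin n → Fin n → Bool
u == v = does (u Fin.≟ v)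

==-refl : ∀ {n} (u : Fin n) → (u == u) ≡ true
==-refl u = dec-true (u Fin.≟ u) refl

==-true : ∀ {n} (u v : Fin n) → (u == v) ≡ true → u ≡ v
==-true u v eq with yes u≡v ← u Fin.≟ v = u≡v

==-false : ∀ {n} {u v : Fin n} → u ≢ v → (u == v) ≡ false
==-false {u = u} {v} = dec-false (u Fin.≟ v)

sum-== : ∀ {n} (z : Fin n) → sum (λ v → 𝟙 (v == z)) ≡ 1
sum-== {suc n} zero    = cong suc (sum-zero {n})
sum-== {suc n} (suc z) = sum-== z

true≢false : true ≢ false
true≢false ()

∨-true : ∀ x {y} → x ∨ y ≡ true → x ≡ true ⊎ y ≡ true
∨-true true  eq = inj₁ refl
∨-true false eq = inj₂ eq

∨-intro : ∀ x {y} → (x ≡ false → y ≡ true) → x ∨ y ≡ true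
∨-intro true  _ = refl
∨-intro false f = f refl

-- Union bound behind the estimate of `cut`. The third set is estimated only outside the second,
-- because `degOff` counts a neighbour only when it lies outside `O`.
∨-bound : ∀ x y {z s} → (y ≡ false → 𝟙 z ≤ s) → 𝟙 (x ∨ (y ∨ z)) ≤ 𝟙 x + (𝟙 y + s)
∨-bound true  _     _ = s≤s z≤n
∨-bound false true  _ = s≤s z≤n
∨-bound false false f = f refl

∧-true : ∀ x {y} → x ∧ y ≡ true → x ≡ true × y ≡ true
∧-true true  eq = refl , eq

∨-falseˡ : ∀ x {y} → x ∨ y ≡ false → x ≡ false
∨-falseˡ false eq = refl

∨-falseʳ : ∀ x {y} → x ∨ y ≡ false → y ≡ false
∨-falseʳ false eq = eq

insert : ∀ {n} → Fin n → (Fin n → Bool) → Fin n → Bool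
insert z S u = (u == z) ∨ S u

insert-old : ∀ {n} (z : Fin n) S {u} → S u ≡ true → insert z S u ≡ true
insert-old z S {u} Su rewrite Su = ∨-zeroʳ (u == z)

insert-new : ∀ {n} (z : Fin n) S → insert z S z ≡ true
insert-new z S rewrite ==-refl z = refl

insert-true : ∀ {n} (z : Fin n) S u → insert z S u ≡ true → u ≡ z ⊎ S u ≡ true
insert-true z S u eq with ∨-true (u == z) eq
... | inj₁ u==z = inj₁ (==-true u z u==z)
... | inj₂ Su   = inj₂ Su

-- Degrees and switching an edge

deg : ∀ {N} → (Fin N → Fin N → Bool) → Fin N → ℕ
deg F u = sum λ v → 𝟙 (F u v)

-- For `u` outside `S`, the degree of `u` once `S` is deleted; only the far endpoint is tested.
degOff : ∀ {N} → (Fin N → Fin N → Bool) → (Fin N → Bool) → Fin N → ℕ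
degOff F S u = sum λ v → 𝟙 (F u v ∧ not (S v))

edge : ∀ {N} → Fin N → Fin N → Fin N → Fin N → Bool
edge p z u v = ((u == p) ∧ (v == z)) ∨ ((u == z) ∧ (v == p))

edge-true : ∀ {N} (p z u v : Fin N) → edge p z u v ≡ true → (u ≡ p × v ≡ z) ⊎ (u ≡ z × v ≡ p)
edge-true p z u v eq with ∨-true ((u == p) ∧ (v == z)) eq
... | inj₁ e = inj₁ (==-true u p (proj₁ (∧-true (u == p) e)) , ==-true v z (proj₂ (∧-true (u == p) e)))
... | inj₂ e = inj₂ (==-true u z (proj₁ (∧-true (u == z) e)) , ==-true v p (proj₂ (∧-true (u == z) e)))

edge-sym : ∀ {N} (p z u v : Fin N) → edge p z u v ≡ edge p z v u
edge-sym p z u v = trans (∨-comm ((u == p) ∧ (v == z)) _)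
  (cong₂ _∨_ (∧-comm (u == z) _) (∧-comm (u == p) _))

deg-edge : ∀ {N} {p z : Fin N} → p ≢ z → ∀ u → deg (edge p z) u ≡ 𝟙 (u == p) + 𝟙 (u == z)
deg-edge {p = p} {z} p≢z u = begin
  sum (λ v → 𝟙 (edge p z u v))
    ≡⟨ sum-cong-≗ pointwise ⟩
  sum (λ v → 𝟙 (u == p) * 𝟙 (v == z) + 𝟙 (u == z) * 𝟙 (v == p))
    ≡⟨ ∑-distrib-+ (λ v → 𝟙 (u == p) * 𝟙 (v == z)) (λ v → 𝟙 (u == z) * 𝟙 (v == p)) ⟩
  sum (λ v → 𝟙 (u == p) * 𝟙 (v == z)) + sum (λ v → 𝟙 (u == z) * 𝟙 (v == p))
    ≡⟨ cong₂ _+_ (point p z) (point z p) ⟩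
  𝟙 (u == p) + 𝟙 (u == z) ∎
  where
  open ≡-Reasoning
  -- Since `p` and `z` differ, the two disjuncts of `edge` exclude each other and the disjunction is
  -- a sum.
  pointwise : ∀ v → 𝟙 (edge p z u v) ≡ 𝟙 (u == p) * 𝟙 (v == z) + 𝟙 (u == z) * 𝟙 (v == p)
  pointwise v with u Fin.≟ p | u Fin.≟ z
  ... | yes refl | yes refl = contradiction refl p≢z
  ... | no _     | no _     = refl
  ... | no _     | yes _    = sym (+-identityʳ _)
  ... | yes _    | no _     with v Fin.≟ z
  ...   | yes _ = refl
  ...   | no _  = refl
  point : ∀ q r → sum (λ v → 𝟙 (u == q) * 𝟙 (v == r)) ≡ 𝟙 (u == q)
  point q r = begin
    sum (λ v → 𝟙 (u == q) * 𝟙 (v == r)) ≡⟨ *-distribˡ-sum (𝟙 (u == q)) (λ v → 𝟙 (v == r)) ⟨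
    𝟙 (u == q) * sum (λ v → 𝟙 (v == r)) ≡⟨ cong (𝟙 (u == q) *_) (sum-== r) ⟩
    𝟙 (u == q) * 1                      ≡⟨ *-identityʳ _ ⟩
    𝟙 (u == q)                          ∎

-- Symmetric difference with a single edge: it adds or deletes according to the current value, so
-- one operation serves both kinds of step on an alternating path.
toggle : ∀ {N} → (Fin N → Fin N → Bool) → Fin N → Fin N → Fin N → Fin N → Bool
toggle F p z u v = F u v xor edge p z u v

-- The (g,f)-factor theorem

module Factor {N : ℕ} (h : Fin N → Fin N → Bool)
  (h-sym : ∀ u v → h u v ≡ h v u) (h-irrefl : ∀ u → h u u ≡ false)
  (g f : Fin N → ℕ) (g<f : ∀ u → g u < f u) where

  record IsSub (F : Fin N → Fin N → Bool) : Set where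
    constructor isSub
    field
      symm : ∀ u v → F u v ≡ F v u
      ⊆h   : ∀ u v → F u v ≡ true → h u v ≡ true
  open IsSub

  edge-const : ∀ {F p z c} → IsSub F → F p z ≡ c → ∀ u v → edge p z u v ≡ true → F u v ≡ c
  edge-const {p = p} {z} sub Fpz u v e with edge-true p z u v e
  ... | inj₁ (refl , refl) = Fpz
  ... | inj₂ (refl , refl) = trans (symm sub z p) Fpz

  toggle-sub : ∀ {F p z} → IsSub F → h p z ≡ true → IsSub (toggle F p z)
  toggle-sub {F} {p} {z} sub hpz = isSub
    (λ u v → cong₂ _xor_ (symm sub u v) (edge-sym p z u v)) incl
    where
    incl : ∀ u v → toggle F p z u v ≡ true → h u v ≡ true
    incl u v eq with edge p z u v in e
    ... | true  = edge-const (isSub h-sym λ _ _ x → x) hpz u v e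
    ... | false = ⊆h sub u v (trans (sym (xor-identityʳ (F u v))) eq)

  sub-irrefl : ∀ {F p z} → IsSub F → h p z ≡ true → p ≢ z
  sub-irrefl sub hpz refl = contradiction (trans (sym hpz) (h-irrefl _)) λ ()

  deg-toggle-add : ∀ {F p z} → IsSub F → h p z ≡ true → F p z ≡ false →
    ∀ u → deg (toggle F p z) u ≡ deg F u + (𝟙 (u == p) + 𝟙 (u == z))
  deg-toggle-add {F} {p} {z} sub hpz Fpz u = begin
    sum (λ v → 𝟙 (toggle F p z u v))          ≡⟨ sum-cong-≗ pointwise ⟩
    sum (λ v → 𝟙 (F u v) + 𝟙 (edge p z u v))  ≡⟨ ∑-distrib-+ (λ v → 𝟙 (F u v)) _ ⟩
    deg F u + deg (edge p z) u                ≡⟨ cong (λ c → deg F u + c) (deg-edge (sub-irrefl sub hpz) u) ⟩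
    deg F u + (𝟙 (u == p) + 𝟙 (u == z))       ∎
    where
    open ≡-Reasoning
    pointwise : ∀ v → 𝟙 (toggle F p z u v) ≡ 𝟙 (F u v) + 𝟙 (edge p z u v)
    pointwise v with edge p z u v in e
    ... | true rewrite edge-const sub Fpz u v e = refl
    ... | false rewrite xor-identityʳ (F u v) = sym (+-identityʳ _)

  -- The larger degree stands alone on the left, so that a deletion is recorded without truncated
  -- subtraction.
  deg-toggle-remove : ∀ {F p z} → IsSub F → F p z ≡ true →
    ∀ u → deg F u ≡ deg (toggle F p z) u + (𝟙 (u == p) + 𝟙 (u == z))
  deg-toggle-remove {F} {p} {z} sub Fpz u = begin
    sum (λ v → 𝟙 (F u v))                                 ≡⟨ sum-cong-≗ pointwise ⟩
    sum (λ v → 𝟙 (toggle F p z u v) + 𝟙 (edge p z u v))   ≡⟨ ∑-distrib-+ (λ v → 𝟙 (toggle F p z u v)) _ ⟩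
    deg (toggle F p z) u + deg (edge p z) u
      ≡⟨ cong (λ c → deg (toggle F p z) u + c) (deg-edge (sub-irrefl sub (⊆h sub p z Fpz)) u) ⟩
    deg (toggle F p z) u + (𝟙 (u == p) + 𝟙 (u == z))      ∎
    where
    open ≡-Reasoning
    pointwise : ∀ v → 𝟙 (F u v) ≡ 𝟙 (toggle F p z u v) + 𝟙 (edge p z u v)
    pointwise v with edge p z u v in e
    ... | true rewrite edge-const sub Fpz u v e = refl
    ... | false rewrite xor-identityʳ (F u v) = sym (+-identityʳ _)

  -- Alternating trees and switching along them.

  visited : (O E : Fin N → Bool) → Fin N → Bool
  visited O E u = O u ∨ E u

  visited-O : ∀ O E z u → visited O E u ≡ true → visited (insert z O) E u ≡ true
  visited-O O E z u eq with u == z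
  ... | true  = refl
  ... | false = eq

  visited-E : ∀ O E z u → visited O E u ≡ true → visited O (insert z E) u ≡ true
  visited-E O E z u eq with O u | u == z
  ... | true  | _     = refl
  ... | false | true  = refl
  ... | false | false = eq

  -- An alternating tree: E holds the vertices at even distance from the root x.
  -- A new vertex is never already visited, so switching its edge to its parent p
  -- leaves F unchanged on the tree built before it.
  data Search (F : Fin N → Fin N → Bool) (x : Fin N) : (O E : Fin N → Bool) → Set where
    root : Search F x (λ _ → false) (_== x)
    odd  : ∀ {O E p z} → Search F x O E → visited O E z ≡ false →
           E p ≡ true → h p z ≡ true → F p z ≡ false → Search F x (insert z O) E
    even : ∀ {O E p z} → Search F x O E → visited O E z ≡ false →
           O p ≡ true → F p z ≡ true → Search F x O (insert z E)

  Agree : (F F₁ : Fin N → Fin N → Bool) (S : Fin N → Bool) → Set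
  Agree F F₁ S = ∀ u v → S u ≡ true → S v ≡ true → F u v ≡ F₁ u v

  Agree-mono : ∀ {F F₁ S} S' → (∀ u → S' u ≡ true → S u ≡ true) → Agree F F₁ S → Agree F F₁ S'
  Agree-mono S' S'⊆S ag u v S'u S'v = ag u v (S'⊆S u S'u) (S'⊆S v S'v)

  Agree-toggle : ∀ {F F₁} S {p z} → Agree F F₁ S → S z ≡ false → Agree F (toggle F₁ p z) S
  Agree-toggle S {p} {z} ag Sz u v Su Sv with edge p z u v in e
  ... | false = trans (ag u v Su Sv) (sym (xor-identityʳ _))
  ... | true with edge-true p z u v e
  ...   | inj₁ (refl , refl) = contradiction (trans (sym Sv) Sz) true≢false
  ...   | inj₂ (refl , refl) = contradiction (trans (sym Su) Sz) true≢false

  -- `e` is the intended degree sequence. The one surplus unit ends at a vertex where `e` is below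
  -- `g`, so it is a gain there and cannot break the bound `f`.
  Reached : (Fin N → ℕ) → Set
  Reached e = ∃ λ F → IsSub F × ∃ λ v → e v < g v × (∀ u → deg F u ≡ e u + 𝟙 (u == v))

  -- Along the path back to the root the degrees stay e, with one unit too many at
  -- an even vertex or one unit missing at an odd one; switching the parent edge
  -- moves that defect to the parent. It stops at the latest at the root.
  module _ {F : Fin N → Fin N → Bool} {x : Fin N} (e : Fin N → ℕ) (ex<gx : e x < g x) where

    flip-even : ∀ {O E} → Search F x O E → ∀ {F₁} → IsSub F₁ → Agree F F₁ (visited O E) →
      ∀ v → E v ≡ true → g v ≤ e v → (∀ u → deg F₁ u ≡ e u + 𝟙 (u == v)) → Reached e

    flip-odd : ∀ {O E} → Search F x O E → ∀ {F₁} → IsSub F₁ → Agree F F₁ (visited O E) →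
      ∀ w → O w ≡ true → (∀ u → deg F₁ u + 𝟙 (u == w) ≡ e u) → Reached e

    -- The root is below `g` under `e`, so a surplus that must be passed on never sits there.
    flip-even root sub ag v Ev gv≤ev d with refl ← ==-true v x Ev = contradiction gv≤ev (<⇒≱ ex<gx)
    flip-even (odd {O} {E} {z = z} s _ _ _ _) sub ag v Ev gv≤ev d =
      flip-even s sub (Agree-mono (visited O E) (visited-O O E z) ag) v Ev gv≤ev d
    flip-even (even {O} {E} {p} {z} s fresh Op Fpz) {F₁} sub ag v Ev gv≤ev d with insert-true z E v Ev
    ... | inj₂ E'v = flip-even s sub (Agree-mono (visited O E) (visited-E O E z) ag) v E'v gv≤ev d
    ... | inj₁ refl = flip-odd s (toggle-sub sub (⊆h sub p z F₁pz))
          (Agree-toggle (visited O E) (Agree-mono (visited O E) (visited-E O E z) ag) fresh) p Op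
          λ u → +-cancelʳ-≡ (𝟙 (u == z)) _ _
            (trans (+-assoc (deg (toggle F₁ p z) u) _ _) (trans (sym (deg-toggle-remove sub F₁pz u)) (d u)))
      where
      -- Both `p` and `z` are visited, so the switched subgraph still agrees with `F` on the parent
      -- edge and the toggle really deletes it.
      F₁pz : F₁ p z ≡ true
      F₁pz = trans (sym (ag p z (visited-E O E z p (cong (_∨ E p) Op))
                     (trans (cong (O z ∨_) (insert-new z E)) (∨-zeroʳ (O z))))) Fpz

    flip-odd (even {O} {E} {z = z} s _ _ _) sub ag w Ow d =
      flip-odd s sub (Agree-mono (visited O E) (visited-E O E z) ag) w Ow d
    flip-odd (odd {O} {E} {p} {z} s fresh Ep hpz Fpz) {F₁} sub ag w Ow d with insert-true z O w Ow
    ... | inj₂ O'w = flip-odd s sub (Agree-mono (visited O E) (visited-O O E z) ag) w O'w d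
    ... | inj₁ refl = stop-or-continue (e p <? g p)
      where
      F₁pz : F₁ p z ≡ false
      F₁pz = trans (sym (ag p z (visited-O O E z p (trans (cong (O p ∨_) Ep) (∨-zeroʳ (O p))))
                     (cong (_∨ E z) (insert-new z O)))) Fpz
      swap : ∀ a b c → a + (b + c) ≡ a + c + b
      swap = solve-∀
      toggled : ∀ u → deg (toggle F₁ p z) u ≡ e u + 𝟙 (u == p)
      toggled u = trans (deg-toggle-add sub hpz F₁pz u)
        (trans (swap (deg F₁ u) (𝟙 (u == p)) (𝟙 (u == z))) (cong (_+ 𝟙 (u == p)) (d u)))
      stop-or-continue : Dec (e p < g p) → Reached e
      stop-or-continue (yes ep<gp) = toggle F₁ p z , toggle-sub sub hpz , p , ep<gp , toggled
      stop-or-continue (no ep≮gp)  = flip-even s (toggle-sub sub hpz)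
        (Agree-toggle (visited O E) (Agree-mono (visited O E) (visited-O O E z) ag) fresh)
        p Ep (≮⇒≥ ep≮gp) toggled

  -- Augmentations, measured by the shortfall.

  Bounded : (Fin N → Fin N → Bool) → Set
  Bounded F = ∀ u → deg F u ≤ f u

  -- Truncated subtraction keeps a surplus at one vertex from offsetting a lack at another; the sum
  -- vanishes exactly when `g` is met everywhere.
  shortfall : (Fin N → Fin N → Bool) → ℕ
  shortfall F = sum λ u → g u ∸ deg F u

  Better : (Fin N → Fin N → Bool) → Set
  Better F = ∃ λ F' → IsSub F' × Bounded F' × shortfall F' < shortfall F

  -- Passing from the degrees of `F` to `e` costs no shortfall, and the extra unit at `v` reduces
  -- it. The upper bound survives at `v` because `e v + 1 ≤ g v < f v`.
  Reached⇒Better : ∀ {F} e → (∀ u → e u ≤ f u) → (∀ u → g u ∸ e u ≤ g u ∸ deg F u) →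
    Reached e → Better F
  Reached⇒Better {F} e e≤f short (F' , sub , v , ev<gv , d) = F' , sub , bounded , sum-mono-< less v less-v
    where
    bounded : Bounded F'
    bounded u rewrite d u with u Fin.≟ v
    ... | yes refl = ≤-trans (≤-trans (≤-reflexive (+-comm (e v) 1)) ev<gv) (<⇒≤ (g<f v))
    ... | no _     = ≤-trans (≤-reflexive (+-identityʳ (e u))) (e≤f u)
    less : ∀ u → g u ∸ deg F' u ≤ g u ∸ deg F u
    less u rewrite d u = ≤-trans (∸-monoʳ-≤ (g u) (m≤m+n (e u) _)) (short u)
    less-v : g v ∸ deg F' v < g v ∸ deg F v
    less-v rewrite d v | ==-refl v =
      <-≤-trans (∸-monoʳ-< (≤-reflexive (+-comm 1 (e v))) (≤-trans (≤-reflexive (+-comm (e v) 1)) ev<gv)) (short v)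

  Deficient : (O E : Fin N → Bool) → Set
  Deficient O E = (∀ u → O u ≡ true → E u ≡ false) ×
    ∑∈ O f + ∑∈ E (degOff h O) < ∑∈ E g

  module Augment {F : Fin N → Fin N → Bool} (sub : IsSub F) (bounded : Bounded F)
    {x : Fin N} (dx<gx : deg F x < g x) where

    root-visited : ∀ {O E} → Search F x O E → E x ≡ true
    root-visited root = ==-refl x
    root-visited (odd s _ _ _ _) = root-visited s
    root-visited (even {E = E} {z = z} s _ _ _) = insert-old z E (root-visited s)

    fresh≢root : ∀ {O E z} → Search F x O E → visited O E z ≡ false → x ≢ z
    fresh≢root {O} {E} s fresh refl =
      contradiction (trans (sym (root-visited s)) (∨-falseʳ (O x) fresh)) true≢false

    -- An odd vertex with room below `f` may gain an edge: the target is the degrees of `F` with one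
    -- more at `z`. Relative to it `F` itself misses one unit at `z`, which is where `flip-odd`
    -- starts.
    augment-odd : ∀ {O E p z} → Search F x O E → visited O E z ≡ false →
      E p ≡ true → h p z ≡ true → F p z ≡ false → deg F z < f z → Better F
    augment-odd {O} {z = z} s fresh Ep hpz Fpz dz<fz = Reached⇒Better e e≤f
      (λ u → ∸-monoʳ-≤ (g u) (m≤m+n (deg F u) _))
      (flip-odd e ex<gx (odd s fresh Ep hpz Fpz) sub (λ _ _ _ _ → refl) z (insert-new z O) λ _ → refl)
      where
      e : Fin N → ℕ
      e u = deg F u + 𝟙 (u == z)
      e≤f : ∀ u → e u ≤ f u
      e≤f u with u Fin.≟ z
      ... | yes refl = ≤-trans (≤-reflexive (+-comm (deg F z) 1)) dz<fz
      ... | no _     = ≤-trans (≤-reflexive (+-identityʳ (deg F u))) (bounded u)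
      ex<gx : e x < g x
      ex<gx rewrite ==-false (fresh≢root s fresh) | +-identityʳ (deg F x) = dx<gx

    -- Dually, an even vertex above `g` can lose an edge without shortfall: the target has one less
    -- at `z`, and `F` carries the surplus that `flip-even` passes on.
    augment-even : ∀ {O E p z} → Search F x O E → visited O E z ≡ false →
      O p ≡ true → F p z ≡ true → g z < deg F z → Better F
    augment-even {E = E} {z = z} s fresh Op Fpz gz<dz = Reached⇒Better e
      (λ u → ≤-trans (m∸n≤m _ (𝟙 (u == z))) (bounded u)) short
      (flip-even e ex<gx (even s fresh Op Fpz) sub (λ _ _ _ _ → refl) z (insert-new z E) gz≤ez d)
      where
      e : Fin N → ℕ
      e u = deg F u ∸ 𝟙 (u == z)
      gz≤ez : g z ≤ e z
      gz≤ez rewrite ==-refl z = <⇒≤pred gz<dz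
      short : ∀ u → g u ∸ e u ≤ g u ∸ deg F u
      short u with u Fin.≟ z
      ... | yes refl = ≤-trans (≤-reflexive (m≤n⇒m∸n≡0 (<⇒≤pred gz<dz))) z≤n
      ... | no _     = ≤-refl
      ex<gx : e x < g x
      ex<gx rewrite ==-false (fresh≢root s fresh) = dx<gx
      d : ∀ u → deg F u ≡ e u + 𝟙 (u == z)
      d u with u Fin.≟ z
      ... | yes refl = sym (m∸n+n≡m (≤-trans (s≤s z≤n) gz<dz))
      ... | no _     = sym (+-identityʳ _)

    -- The invariant of a search that has met no augmentation. `OO-edge` and `EE-edge` say that no
    -- admissible step leads from a class back into itself.
    record Stuck (O E : Fin N → Bool) : Set where
      field
        O-full  : ∀ u → O u ≡ true → f u ≤ deg F u
        E-low   : ∀ u → E u ≡ true → deg F u ≤ g u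
        OO-edge : ∀ u v → O u ≡ true → O v ≡ true → F u v ≡ false
        EE-edge : ∀ u v → E u ≡ true → E v ≡ true → h u v ≡ true → F u v ≡ true
        disj    : ∀ u → O u ≡ true → E u ≡ false
    open Stuck

    stuck-root : Stuck (λ _ → false) (_== x)
    stuck-root = record
      { O-full  = λ _ ()
      ; E-low   = λ u u==x → subst (λ w → deg F w ≤ g w) (sym (==-true u x u==x)) (<⇒≤ dx<gx)
      ; OO-edge = λ _ _ ()
      ; EE-edge = λ u v u==x v==x huv → contradiction
          (trans (sym huv) (subst₂ (λ a b → h a b ≡ false) (sym (==-true u x u==x)) (sym (==-true v x v==x)) (h-irrefl x)))
          true≢false
      ; disj    = λ _ ()
      }

    OddStep : (E : Fin N → Bool) → Fin N → Set
    OddStep E z = ∃ λ p → E p ≡ true × h p z ≡ true × F p z ≡ false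

    EvenStep : (O : Fin N → Bool) → Fin N → Set
    EvenStep O z = ∃ λ p → O p ≡ true × F p z ≡ true

    oddStep? : ∀ E z → Dec (OddStep E z)
    oddStep? E z = any? λ p → (E p Bool.≟ true) ×-dec (h p z Bool.≟ true) ×-dec (F p z Bool.≟ false)

    evenStep? : ∀ O z → Dec (EvenStep O z)
    evenStep? O z = any? λ p → (O p Bool.≟ true) ×-dec (F p z Bool.≟ true)

    -- Without an even step into `z`, no edge of `F` joins `z` to the old `O`, which is what
    -- `OO-edge` asks of the new vertex.
    stuck-odd : ∀ {O E z} → Stuck O E → visited O E z ≡ false → f z ≤ deg F z → ¬ EvenStep O z →
      Stuck (insert z O) E
    stuck-odd {O} {E} {z} st fresh fz≤dz none = record
      { O-full  = λ u → full u ∘′ insert-true z O u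
      ; E-low   = E-low st
      ; OO-edge = λ u v Ou Ov → noedge u v (insert-true z O u Ou) (insert-true z O v Ov)
      ; EE-edge = EE-edge st
      ; disj    = λ u → dis u ∘′ insert-true z O u
      }
      where
      full : ∀ u → u ≡ z ⊎ O u ≡ true → f u ≤ deg F u
      full u (inj₁ refl) = fz≤dz
      full u (inj₂ Ou)   = O-full st u Ou
      noedge : ∀ u v → u ≡ z ⊎ O u ≡ true → v ≡ z ⊎ O v ≡ true → F u v ≡ false
      noedge u v (inj₂ Ou)   (inj₂ Ov)   = OO-edge st u v Ou Ov
      noedge u v (inj₂ Ou)   (inj₁ refl) = ¬-not {y = true} λ Fuz → none (u , Ou , Fuz)
      noedge u v (inj₁ refl) (inj₂ Ov)   = trans (symm sub z v) (¬-not {y = true} λ Fvz → none (v , Ov , Fvz))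
      noedge u v (inj₁ refl) (inj₁ refl) = ¬-not {y = true} λ Fzz →
        contradiction refl (sub-irrefl sub (⊆h sub z z Fzz))
      dis : ∀ u → u ≡ z ⊎ O u ≡ true → E u ≡ false
      dis u (inj₁ refl) = ∨-falseʳ (O z) fresh
      dis u (inj₂ Ou)   = disj st u Ou

    stuck-even : ∀ {O E z} → Stuck O E → visited O E z ≡ false → deg F z ≤ g z → ¬ OddStep E z →
      Stuck O (insert z E)
    stuck-even {O} {E} {z} st fresh dz≤gz none = record
      { O-full  = O-full st
      ; E-low   = λ u → low u ∘′ insert-true z E u
      ; OO-edge = OO-edge st
      ; EE-edge = λ u v Eu Ev → alledge u v (insert-true z E u Eu) (insert-true z E v Ev)
      ; disj    = dis
      }
      where
      low : ∀ u → u ≡ z ⊎ E u ≡ true → deg F u ≤ g u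
      low u (inj₁ refl) = dz≤gz
      low u (inj₂ Eu)   = E-low st u Eu
      alledge : ∀ u v → u ≡ z ⊎ E u ≡ true → v ≡ z ⊎ E v ≡ true → h u v ≡ true → F u v ≡ true
      alledge u v (inj₂ Eu)   (inj₂ Ev)   huv = EE-edge st u v Eu Ev huv
      alledge u v (inj₂ Eu)   (inj₁ refl) huz = ¬-not {y = false} λ Fuz → none (u , Eu , huz , Fuz)
      alledge u v (inj₁ refl) (inj₂ Ev)   hzv = trans (symm sub z v)
        (¬-not {y = false} λ Fvz → none (v , Ev , trans (h-sym v z) hzv , Fvz))
      alledge u v (inj₁ refl) (inj₁ refl) hzz = contradiction refl (sub-irrefl sub hzz)
      dis : ∀ u → O u ≡ true → insert z E u ≡ false
      dis u Ou = trans (cong (_∨ E u) (==-false {u = u} {z} λ { refl →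
        contradiction (trans (sym Ou) (∨-falseˡ (O z) fresh)) true≢false })) (disj st u Ou)

    Closed : (O E : Fin N → Bool) → Set
    Closed O E = ∀ z → visited O E z ≡ false → ¬ OddStep E z × ¬ EvenStep O z

    unvisited : (O E : Fin N → Bool) → ℕ
    unvisited O E = sum λ u → 𝟙 (not (visited O E u))

    unvisited-decreases : ∀ O E O' E' z → (∀ u → visited O E u ≡ true → visited O' E' u ≡ true) →
      visited O E z ≡ false → visited O' E' z ≡ true → unvisited O' E' < unvisited O E
    unvisited-decreases O E O' E' z mono fresh new = sum-mono-< le z lt
      where
      le : ∀ u → 𝟙 (not (visited O' E' u)) ≤ 𝟙 (not (visited O E u))
      le u with visited O E u | visited O' E' u | mono u
      ... | true  | true  | _ = z≤n
      ... | true  | false | m = contradiction (sym (m refl)) true≢false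
      ... | false | true  | _ = z≤n
      ... | false | false | _ = s≤s z≤n
      lt : 𝟙 (not (visited O' E' z)) < 𝟙 (not (visited O E z))
      lt rewrite fresh | new = s≤s z≤n

    -- A fresh vertex with both an odd and an even step always yields an augmentation: either it has
    -- room below `f` and gains an edge, or its degree is at least `f`, hence above `g`, and it can
    -- lose one. So each vertex enters with a single parity and no blossoms have to be contracted.
    -- The fuel `k` exceeds the number of unvisited vertices, which drops at each extension.
    explore : ∀ k {O E} → unvisited O E < k → Search F x O E → Stuck O E →
      Better F ⊎ ∃ λ O → ∃ λ E → E x ≡ true × Stuck O E × Closed O E
    explore (suc k) {O} {E} (s≤s u≤k) s st
      with any? (λ z → (visited O E z Bool.≟ false) ×-dec (oddStep? E z ⊎-dec evenStep? O z))
    ... | no none = inj₂ (O , E , root-visited s , st , λ z fresh →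
            (λ o → none (z , fresh , inj₁ o)) , (λ e → none (z , fresh , inj₂ e)))
    ... | yes (z , fresh , step) with oddStep? E z | evenStep? O z | step
    ...   | no ¬o | _     | inj₁ o = contradiction o ¬o
    ...   | no _  | no ¬e | inj₂ e = contradiction e ¬e
    -- An even step is followed only when no odd step leads to `z`, the condition that `stuck-even`
    -- needs.
    ...   | no ¬o | yes (p , Op , Fpz) | inj₂ _ with g z <? deg F z
    ...     | yes gz<dz = inj₁ (augment-even s fresh Op Fpz gz<dz)
    ...     | no gz≮dz  = explore k
                (<-≤-trans (unvisited-decreases O E O (insert z E) z (visited-E O E z) fresh
                  (trans (cong (O z ∨_) (insert-new z E)) (∨-zeroʳ (O z)))) u≤k)
                (even s fresh Op Fpz) (stuck-even st fresh (≮⇒≥ gz≮dz) ¬o)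
    explore (suc k) {O} {E} (s≤s u≤k) s st
        | yes (z , fresh , _) | yes (p , Ep , hpz , Fpz) | e? | _ with deg F z <? f z | e?
    ...     | yes dz<fz | _ = inj₁ (augment-odd s fresh Ep hpz Fpz dz<fz)
    ...     | no dz≮fz | yes (q , Oq , Fqz) = inj₁ (augment-even s fresh Oq Fqz (<-≤-trans (g<f z) (≮⇒≥ dz≮fz)))
    ...     | no dz≮fz | no ¬e = explore k
                (<-≤-trans (unvisited-decreases O E (insert z O) E z (visited-O O E z) fresh
                  (cong (_∨ E z) (insert-new z O))) u≤k)
                (odd s fresh Ep hpz Fpz) (stuck-odd st fresh (≮⇒≥ dz≮fz) ¬e)

    -- Double counting of the edges of `F` between `O` and `E`. Every edge of `F` at `O` ends in
    -- `E`, so their number is at least the sum of `f` over `O`. For `v` in `E`, every neighbour in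
    -- `h` outside `O` is a neighbour in `F`, so the edges from `v` to `O` and `degOff h O v`
    -- together fit into `deg F v`. On `E` these degrees are at most `g`, strictly so at the root
    -- `x`.
    deficient : ∀ {O E} → E x ≡ true → Stuck O E → Closed O E → Deficient O E
    deficient {O} {E} Ex st closed = disj st , (begin-strict
      sum (λ u → 𝟙 (O u) * f u) + sum (λ v → 𝟙 (E v) * degOff h O v)
        ≤⟨ +-monoˡ-≤ _ (sum-mono-≤ from-O) ⟩
      sum (λ u → sum λ v → 𝟙 (E v) * 𝟙 (F v u ∧ O u)) + sum (λ v → 𝟙 (E v) * degOff h O v)
        ≡⟨ cong (_+ sum (λ v → 𝟙 (E v) * degOff h O v)) (∑-comm (λ u v → 𝟙 (E v) * 𝟙 (F v u ∧ O u))) ⟩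
      sum (λ v → sum λ u → 𝟙 (E v) * 𝟙 (F v u ∧ O u)) + sum (λ v → 𝟙 (E v) * degOff h O v)
        ≡⟨ ∑-distrib-+ (λ v → sum λ u → 𝟙 (E v) * 𝟙 (F v u ∧ O u)) _ ⟨
      sum (λ v → sum (λ u → 𝟙 (E v) * 𝟙 (F v u ∧ O u)) + 𝟙 (E v) * degOff h O v)
        ≤⟨ sum-mono-≤ (λ v → at v) ⟩
      sum (λ v → 𝟙 (E v) * deg F v)
        <⟨ sum-mono-< low x low-x ⟩
      sum (λ v → 𝟙 (E v) * g v) ∎)
      where
      open ≤-Reasoning
      O⇒E : ∀ u v → O u ≡ true → F u v ≡ true → E v ≡ true
      O⇒E u v Ou Fuv with E v in Ev | O v in Ov
      ... | true  | _     = refl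
      ... | false | true  = contradiction (trans (sym Fuv) (OO-edge st u v Ou Ov)) true≢false
      ... | false | false = contradiction (u , Ou , Fuv) (proj₂ (closed v (cong₂ _∨_ Ov Ev)))
      from-O : ∀ u → 𝟙 (O u) * f u ≤ sum (λ v → 𝟙 (E v) * 𝟙 (F v u ∧ O u))
      from-O u with O u in Ou
      ... | false = z≤n
      ... | true  = ≤-trans (≤-reflexive (+-identityʳ (f u))) (≤-trans (O-full st u Ou) (sum-mono-≤ λ v → le v))
        where
        le : ∀ v → 𝟙 (F u v) ≤ 𝟙 (E v) * 𝟙 (F v u ∧ true)
        le v with F u v in Fuv
        ... | false = z≤n
        ... | true rewrite trans (symm sub v u) Fuv | O⇒E u v Ou Fuv = ≤-refl
      split : ∀ v → E v ≡ true → ∀ u → 𝟙 (F v u ∧ O u) + 𝟙 (h v u ∧ not (O u)) ≤ 𝟙 (F v u)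
      split v Ev u with F v u in Fvu | h v u in hvu | O u in Ou
      ... | true  | true  | true  = ≤-refl
      ... | true  | true  | false = ≤-refl
      ... | true  | false | true  = ≤-refl
      ... | true  | false | false = z≤n
      ... | false | false | _     = z≤n
      ... | false | true  | true  = z≤n
      ... | false | true  | false with E u in Eu
      ...   | true  = contradiction (trans (sym (EE-edge st v u Ev Eu hvu)) Fvu) true≢false
      ...   | false = contradiction (v , Ev , hvu , Fvu) (proj₁ (closed u (cong₂ _∨_ Ou Eu)))
      at : ∀ v → sum (λ u → 𝟙 (E v) * 𝟙 (F v u ∧ O u)) + 𝟙 (E v) * degOff h O v ≤ 𝟙 (E v) * deg F v
      at v with E v in Ev
      ... | false = ≤-reflexive (trans (+-identityʳ _) (sum-zero {N}))
      ... | true  = begin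
        sum (λ u → 1 * 𝟙 (F v u ∧ O u)) + 1 * degOff h O v
          ≡⟨ cong₂ _+_ (sum-cong-≗ λ u → *-identityˡ (𝟙 (F v u ∧ O u))) (*-identityˡ _) ⟩
        sum (λ u → 𝟙 (F v u ∧ O u)) + degOff h O v
          ≡⟨ ∑-distrib-+ (λ u → 𝟙 (F v u ∧ O u)) _ ⟨
        sum (λ u → 𝟙 (F v u ∧ O u) + 𝟙 (h v u ∧ not (O u)))
          ≤⟨ sum-mono-≤ (split v Ev) ⟩
        deg F v
          ≡⟨ *-identityˡ _ ⟨
        1 * deg F v ∎
      low : ∀ v → 𝟙 (E v) * deg F v ≤ 𝟙 (E v) * g v
      low v with E v in Ev
      ... | false = z≤n
      ... | true  = *-monoʳ-≤ 1 (E-low st v Ev)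
      low-x : 𝟙 (E x) * deg F x < 𝟙 (E x) * g x
      low-x rewrite Ex = *-monoʳ-< 1 dx<gx

    better-or-deficient : Better F ⊎ ∃ λ O → ∃ λ E → Deficient O E
    better-or-deficient with explore _ ≤-refl root stuck-root
    ... | inj₁ better                  = inj₁ better
    ... | inj₂ (O , E , Ex , st , closed) = inj₂ (O , E , deficient Ex st closed)

  -- Iterating augmentations.

  Factor : Set
  Factor = ∃ λ F → IsSub F × (∀ u → g u ≤ deg F u × deg F u ≤ f u)

  improve : ∀ k {F} → shortfall F < k → IsSub F → Bounded F → Factor ⊎ ∃ λ O → ∃ λ E → Deficient O E
  improve (suc k) {F} (s≤s le) sub bounded with any? (λ x → deg F x <? g x)
  ... | no none = inj₁ (F , sub , λ u → ≮⇒≥ (λ lt → none (u , lt)) , bounded u)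
  ... | yes (x , dx<gx) with Augment.better-or-deficient sub bounded dx<gx
  ...   | inj₂ def = inj₂ def
  ...   | inj₁ (F' , sub' , bounded' , lt) = improve k (<-≤-trans lt le) sub' bounded'

  factor-or-deficient : Factor ⊎ ∃ λ O → ∃ λ E → Deficient O E
  factor-or-deficient = improve _ {λ _ _ → false} ≤-refl (isSub (λ _ _ → refl) λ _ _ ())
    λ u → ≤-trans (≤-reflexive (sum-zero {N})) z≤n

-- Greedy independent sets

minimiser : ∀ {N} (T : Fin N → Bool) (d : Fin N → ℕ) {u} → T u ≡ true →
  ∃ λ m → T m ≡ true × ∀ v → T v ≡ true → d m ≤ d v
minimiser T d {u} Tu = descend (suc (d u)) u Tu ≤-refl
  where
  descend : ∀ k u → T u ≡ true → d u < k → ∃ λ m → T m ≡ true × ∀ v → T v ≡ true → d m ≤ d v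
  descend (suc k) u Tu (s≤s du≤k) with any? (λ v → (T v Bool.≟ true) ×-dec (d v <? d u))
  ... | yes (v , Tv , dv<du) = descend k v Tv (<-≤-trans dv<du du≤k)
  ... | no none = u , Tu , λ v Tv → ≮⇒≥ λ dv<du → none (v , Tv , dv<du)

∑∈-mono : ∀ {N} (S : Fin N → Bool) {w w' : Fin N → ℕ} → (∀ u → S u ≡ true → w u ≤ w' u) → ∑∈ S w ≤ ∑∈ S w'
∑∈-mono S {w} {w'} le = sum-mono-≤ pointwise
  where
  pointwise : ∀ u → 𝟙 (S u) * w u ≤ 𝟙 (S u) * w' u
  pointwise u with S u in Su
  ... | true  = *-monoʳ-≤ 1 (le u Su)
  ... | false = z≤n

∑∈-cong : ∀ {N} (S : Fin N → Bool) {w w' : Fin N → ℕ} → (∀ u → S u ≡ true → w u ≡ w' u) → ∑∈ S w ≡ ∑∈ S w'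
∑∈-cong S eq = ≤-antisym (∑∈-mono S λ u Su → ≤-reflexive (eq u Su))
                         (∑∈-mono S λ u Su → ≤-reflexive (sym (eq u Su)))

∑∈-+ : ∀ {N} (S : Fin N → Bool) (w w' : Fin N → ℕ) → ∑∈ S (λ u → w u + w' u) ≡ ∑∈ S w + ∑∈ S w'
∑∈-+ S w w' = trans (sum-cong-≗ λ u → *-distribˡ-+ (𝟙 (S u)) (w u) (w' u)) (∑-distrib-+ (λ u → 𝟙 (S u) * w u) _)

∑∈-*ʳ : ∀ {N} (S : Fin N → Bool) (w : Fin N → ℕ) c → ∑∈ S (λ u → w u * c) ≡ ∑∈ S w * c
∑∈-*ʳ S w c = trans (sum-cong-≗ λ u → sym (*-assoc (𝟙 (S u)) (w u) c))
                    (sym (*-distribʳ-sum c (λ u → 𝟙 (S u) * w u)))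

∑∈-const : ∀ {N} (S : Fin N → Bool) c → ∑∈ S (λ _ → c) ≡ size S * c
∑∈-const S c = sym (*-distribʳ-sum c λ u → 𝟙 (S u))

∑∈-insert : ∀ {N} z (S : Fin N → Bool) w → S z ≡ false → ∑∈ (insert z S) w ≡ w z + ∑∈ S w
∑∈-insert z S w Sz = begin
  ∑∈ (insert z S) w                                          ≡⟨ sum-cong-≗ pointwise ⟩
  sum (λ u → 𝟙 (u == z) * w z + 𝟙 (S u) * w u)               ≡⟨ ∑-distrib-+ (λ u → 𝟙 (u == z) * w z) _ ⟩
  sum (λ u → 𝟙 (u == z) * w z) + ∑∈ S w                      ≡⟨ cong (_+ ∑∈ S w) (*-distribʳ-sum (w z) λ u → 𝟙 (u == z)) ⟨
  sum (λ u → 𝟙 (u == z)) * w z + ∑∈ S w                      ≡⟨ cong (λ c → c * w z + ∑∈ S w) (sum-== z) ⟩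
  1 * w z + ∑∈ S w                                           ≡⟨ cong (_+ ∑∈ S w) (*-identityˡ (w z)) ⟩
  w z + ∑∈ S w                                               ∎
  where
  open ≡-Reasoning
  pointwise : ∀ u → 𝟙 (insert z S u) * w u ≡ 𝟙 (u == z) * w z + 𝟙 (S u) * w u
  pointwise u with u Fin.≟ z
  ... | yes refl rewrite Sz = sym (+-identityʳ _)
  ... | no _     = refl

module Greedy {N : ℕ} (h : Fin N → Fin N → Bool)
  (h-sym : ∀ u v → h u v ≡ h v u) (h-irrefl : ∀ u → h u u ≡ false)
  (S : Fin N → Bool) (w : Fin N → ℕ)
  (antitone : ∀ u v → degOff h S u ≤ degOff h S v → w v ≤ w u) where

  private
    d : Fin N → ℕ
    d = degOff h S

  IndependentCover : (Fin N → Bool) → Set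
  IndependentCover T = ∃ λ I →
    (∀ u → I u ≡ true → T u ≡ true) ×
    (∀ u v → I u ≡ true → I v ≡ true → h u v ≡ false) ×
    ∑∈ T w ≤ ∑∈ I λ u → suc (d u) * w u

  -- Take `m` of least degree in `T`, hence of greatest weight, and drop it with its neighbours. As
  -- `T` avoids `S`, the dropped neighbours are among the `d m` counted by `degOff`, so the loss is
  -- at most `suc (d m) * w m`, the term that `m` contributes.
  greedy : ∀ k T → size T < k → (∀ u → S u ≡ true → T u ≡ false) → IndependentCover T
  greedy (suc k) T (s≤s size≤k) disj with any? (λ u → T u Bool.≟ true)
  ... | no none = (λ _ → false) , (λ _ ()) , (λ _ _ ()) ,
    ≤-trans (∑∈-mono T {w' = λ _ → 0} λ u Tu → contradiction (u , Tu) none)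
            (≤-reflexive (trans (∑∈-const T 0) (trans (*-zeroʳ (size T)) (sym (sum-zero {N})))))
  ... | yes (_ , Tu) with m , Tm , least ← minimiser T d Tu = extend (greedy k T' (<-≤-trans smaller size≤k) disj')
    where
    T' : Fin N → Bool
    T' u = T u ∧ (not (u == m) ∧ not (h m u))
    T'⊆T : ∀ u → T' u ≡ true → T u ≡ true
    T'⊆T u = proj₁ ∘′ ∧-true (T u)
    T'm : T' m ≡ false
    T'm rewrite ==-refl m = ∧-zeroʳ (T m)
    T'-nonadj : ∀ u → T' u ≡ true → h m u ≡ false
    T'-nonadj u T'u with h m u | proj₂ (∧-true (not (u == m)) (proj₂ (∧-true (T u) T'u)))
    ... | false | _ = refl
    smaller : size T' < size T
    smaller = sum-mono-< le m lt
      where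
      le : ∀ u → 𝟙 (T' u) ≤ 𝟙 (T u)
      le u with T u | not (u == m) ∧ not (h m u)
      ... | true  | true  = s≤s z≤n
      ... | true  | false = z≤n
      ... | false | _     = z≤n
      lt : 𝟙 (T' m) < 𝟙 (T m)
      lt rewrite T'm | Tm = s≤s z≤n
    disj' : ∀ u → S u ≡ true → T' u ≡ false
    disj' u Su rewrite disj u Su = refl
    cover : ∀ u → 𝟙 (T u) * w u ≤ 𝟙 (T' u) * w u + (𝟙 (u == m) + 𝟙 (h m u ∧ not (S u))) * w m
    cover u with T u in Tu | S u in Su
    ... | false | _    = z≤n
    ... | true  | true = contradiction (trans (sym Tu) (disj u Su)) true≢false
    ... | true  | false with u == m | h m u
    ...   | false | false = m≤m+n _ _
    ...   | true  | b     = ≤-trans (*-monoʳ-≤ 1 (antitone m u (least u Tu)))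
                              (*-monoˡ-≤ (w m) (m≤m+n 1 (𝟙 (b ∧ true))))
    ...   | false | true  = *-monoʳ-≤ 1 (antitone m u (least u Tu))
    extend : IndependentCover T' → IndependentCover T
    extend (I , I⊆T' , indep , bound) = insert m I , I⁺⊆T , indep⁺ , bound⁺
      where
      I⁺⊆T : ∀ u → insert m I u ≡ true → T u ≡ true
      I⁺⊆T u Iu with insert-true m I u Iu
      ... | inj₁ refl = Tm
      ... | inj₂ I'u  = T'⊆T u (I⊆T' u I'u)
      indep⁺ : ∀ u v → insert m I u ≡ true → insert m I v ≡ true → h u v ≡ false
      indep⁺ u v Iu Iv with insert-true m I u Iu | insert-true m I v Iv
      ... | inj₁ refl | inj₁ refl = h-irrefl m
      ... | inj₁ refl | inj₂ I'v  = T'-nonadj v (I⊆T' v I'v)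
      ... | inj₂ I'u  | inj₁ refl = trans (h-sym u m) (T'-nonadj u (I⊆T' u I'u))
      ... | inj₂ I'u  | inj₂ I'v  = indep u v I'u I'v
      m∉I : I m ≡ false
      m∉I with I m in Im
      ... | false = refl
      ... | true  = trans (sym (I⊆T' m Im)) T'm
      open ≤-Reasoning
      bound⁺ : ∑∈ T w ≤ ∑∈ (insert m I) λ u → suc (d u) * w u
      bound⁺ = begin
        ∑∈ T w
          ≤⟨ sum-mono-≤ cover ⟩
        sum (λ u → 𝟙 (T' u) * w u + (𝟙 (u == m) + 𝟙 (h m u ∧ not (S u))) * w m)
          ≡⟨ ∑-distrib-+ (λ u → 𝟙 (T' u) * w u) _ ⟩
        ∑∈ T' w + sum (λ u → (𝟙 (u == m) + 𝟙 (h m u ∧ not (S u))) * w m)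
          ≡⟨ cong (λ c → ∑∈ T' w + c) (*-distribʳ-sum (w m) λ u → 𝟙 (u == m) + 𝟙 (h m u ∧ not (S u))) ⟨
        ∑∈ T' w + sum (λ u → 𝟙 (u == m) + 𝟙 (h m u ∧ not (S u))) * w m
          ≡⟨ cong (λ c → ∑∈ T' w + c * w m)
               (trans (∑-distrib-+ (λ u → 𝟙 (u == m)) _) (cong (_+ d m) (sum-== m))) ⟩
        ∑∈ T' w + suc (d m) * w m
          ≤⟨ +-monoˡ-≤ _ bound ⟩
        (∑∈ I λ u → suc (d u) * w u) + suc (d m) * w m
          ≡⟨ +-comm _ (suc (d m) * w m) ⟩
        suc (d m) * w m + (∑∈ I λ u → suc (d u) * w u)
          ≡⟨ ∑∈-insert m I (λ u → suc (d u) * w u) m∉I ⟨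
        (∑∈ (insert m I) λ u → suc (d u) * w u) ∎

-- Isolated toughness

∣∣-size : ∀ {N} (p : Subset N) → ∣ p ∣ ≡ size (Vec.lookup p)
∣∣-size []          = refl
∣∣-size (true  ∷ p) = cong suc (∣∣-size p)
∣∣-size (false ∷ p) = ∣∣-size p

∣tabulate∣-size : ∀ {N} (S : Fin N → Bool) → ∣ Vec.tabulate S ∣ ≡ size S
∣tabulate∣-size S = trans (∣∣-size (Vec.tabulate S)) (sum-cong-≗ λ u → cong 𝟙 (lookup∘tabulate S u))

∈-tabulate⁻ : ∀ {N} (S : Fin N → Bool) {u} → u ∈ Vec.tabulate S → S u ≡ true
∈-tabulate⁻ S {u} u∈ = trans (sym (lookup∘tabulate S u)) ([]=⇒lookup u∈)

∈-tabulate⁺ : ∀ {N} (S : Fin N → Bool) {u} → S u ≡ true → u ∈ Vec.tabulate S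
∈-tabulate⁺ S {u} Su = lookup⇒[]= u _ (trans (lookup∘tabulate S u) Su)

size-⊆ : ∀ {N} {S S' : Fin N → Bool} → (∀ u → S u ≡ true → S' u ≡ true) → size S ≤ size S'
size-⊆ {S = S} {S'} S⊆S' = sum-mono-≤ le
  where
  le : ∀ u → 𝟙 (S u) ≤ 𝟙 (S' u)
  le u with S u | S⊆S' u
  ... | false | _ = z≤n
  ... | true  | f rewrite f refl = s≤s z≤n

size-subsingleton : ∀ {N} {S : Fin N → Bool} → (∀ u v → S u ≡ true → S v ≡ true → u ≡ v) → size S ≤ 1
size-subsingleton {N} {S} eq with any? (λ u → S u Bool.≟ true)
... | yes (x , Sx) = ≤-trans (size-⊆ λ u Su → trans (cong (_== x) (eq u x Su Sx)) (==-refl x)) (≤-reflexive (sum-== x))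
... | no none      = ≤-trans (size-⊆ {S' = λ _ → false} λ u Su → contradiction (u , Su) none)
                       (≤-trans (≤-reflexive (sum-zero {N})) z≤n)

isolatedSet-complete : ∀ {N} (G : Graph N) (S : Subset N) {v} → IsolatedIn G S v → Vec.lookup (isolatedSet G S) v ≡ true
isolatedSet-complete G S {v} (v∉S , nbrs) = trans (lookup∘tabulate _ v) body
  where
  body : (if does (v ∈? S) then outside
          else (if does (all? λ u → (u ∈? adj G v) →-dec (u ∈? S)) then inside else outside)) ≡ true
  body rewrite dec-false (v ∈? S) v∉S | dec-true (all? λ u → (u ∈? adj G v) →-dec (u ∈? S)) nbrs = refl

-- The toughness inequality with denominators cleared, for `m = a - 1`, so that all later arithmetic
-- stays in ℕ.
ratio-bound : ∀ m n b s i (h : 2 ≤ i) →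
  (+ (m + n) / 1) +ℚ (+ m / suc b) ≤ℚ ratio s i h → (suc b * (m + n) + m) * i ≤ suc b * s
-- Matching on `suc i` lets the denominator of `ratio` reduce, so that cross-multiplication has the
-- shape shown.
ratio-bound m n b s (suc i) h le = begin
  (suc b * (m + n) + m) * suc i         ≡⟨ lhs (suc b) (m + n) m (suc i) ⟩
  ((m + n) * suc b + m * 1) * suc i     ≤⟨ ℤ.drop‿+≤+ (subst₂ ℤ._≤_ (sym push) (sym (ℤ.pos-* s (1 * suc b))) (drop-*≤* le)) ⟩
  s * (1 * suc b)                       ≡⟨ rhs s (suc b) ⟩
  suc b * s                             ∎
  where
  open ≤-Reasoning
  lhs : ∀ b k m i → (b * k + m) * i ≡ (k * b + m * 1) * i
  lhs = solve-∀
  rhs : ∀ s b → s * (1 * b) ≡ b * s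
  rhs = solve-∀
  push : + (((m + n) * suc b + m * 1) * suc i) ≡ (+ (m + n) ℤ.* + suc b ℤ.+ + m ℤ.* + 1) ℤ.* + suc i
  push = trans (ℤ.pos-* ((m + n) * suc b + m * 1) (suc i)) (cong (ℤ._* + suc i)
    (trans (ℤ.pos-+ ((m + n) * suc b) (m * 1)) (cong₂ ℤ._+_ (ℤ.pos-* (m + n) (suc b)) (ℤ.pos-* m 1))))

-- The graph left by deleting `V'`.

module Deletion {m b n : ℕ} (a<b : suc m < suc b) (1≤n : 1 ≤ n) {N : ℕ} (G : Graph N)
  (minDeg : MinDegreeAtLeast G (suc m + n))
  (tough : IsolToughnessAtLeast G ((+ (m + n) / 1) +ℚ (+ m / suc b)))
  (V' : Subset N) (∣V'∣≡n : ∣ V' ∣ ≡ n) where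

  removed : Fin N → Bool
  removed = Vec.lookup V'

  -- The vertex type is kept: deleted vertices stay as isolated ones.
  h : Fin N → Fin N → Bool
  h u v = Vec.lookup (adj G v) u ∧ (not (removed u) ∧ not (removed v))

  adj-sym : ∀ u v → Vec.lookup (adj G v) u ≡ Vec.lookup (adj G u) v
  adj-sym u v with Vec.lookup (adj G v) u in e | Vec.lookup (adj G u) v in e'
  ... | true  | true  = refl
  ... | false | false = refl
  ... | true  | false = contradiction (trans (sym ([]=⇒lookup (Graph.sym G u v (lookup⇒[]= u _ e)))) e') true≢false
  ... | false | true  = contradiction (trans (sym ([]=⇒lookup (Graph.sym G v u (lookup⇒[]= v _ e')))) e) true≢false

  h-sym : ∀ u v → h u v ≡ h v u
  h-sym u v = cong₂ _∧_ (adj-sym u v) (∧-comm (not (removed u)) _)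

  h-irrefl : ∀ u → h u u ≡ false
  h-irrefl u with Vec.lookup (adj G u) u in e
  ... | true  = contradiction (lookup⇒[]= u _ e) (irrefl G u)
  ... | false = refl

  h⇒adj : ∀ u v → h u v ≡ true → u ∈ adj G v
  h⇒adj u v huv = lookup⇒[]= u _ (proj₁ (∧-true (Vec.lookup (adj G v) u) huv))

  h⇒kept : ∀ u v → h u v ≡ true → removed u ≡ false
  h⇒kept u v huv with removed u | proj₂ (∧-true (Vec.lookup (adj G v) u) huv)
  ... | false | _ = refl

  -- The value 0 at deleted vertices makes their isolation harmless and keeps the lower bound
  -- strictly below `suc b`.
  lower : Fin N → ℕ
  lower u = if removed u then 0 else suc m

  lower<upper : ∀ u → lower u < suc b
  lower<upper u with removed u
  ... | true  = s≤s z≤n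
  ... | false = a<b

  open Factor h h-sym h-irrefl lower (λ _ → suc b) lower<upper

  Factor⇒HasFactor : Factor → HasFactorOfDeletion G V' (suc m) (suc b)
  Factor⇒HasFactor (F , sub , bounds) = H , F⊆G , avoids , within
    where
    open IsSub sub
    F-at : ∀ {u v} → u ∈ Vec.tabulate (F v) → F u v ≡ true
    F-at {u} {v} u∈ = trans (symm u v) (∈-tabulate⁻ (F v) u∈)
    H : Graph N
    H = record
      { adj    = λ v → Vec.tabulate (F v)
      ; irrefl = λ v v∈ → sub-irrefl sub (⊆h v v (F-at v∈)) refl
      ; sym    = λ u v u∈ → ∈-tabulate⁺ (F u) (F-at u∈)
      }
    F⊆G : ∀ u v → u ∈ adj H v → u ∈ adj G v
    F⊆G u v u∈ = h⇒adj u v (⊆h u v (F-at u∈))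
    avoids : ∀ u v → u ∈ adj H v → u ∉ V'
    avoids u v u∈ u∈V' = contradiction
      (trans (sym ([]=⇒lookup u∈V')) (h⇒kept u v (⊆h u v (F-at u∈)))) true≢false
    within : ∀ v → v ∉ V' → suc m ≤ degree H v × degree H v ≤ suc b
    within v v∉V' with removed v in e | bounds v
    ... | true  | _       = contradiction (lookup⇒[]= v _ e) v∉V'
    ... | false | lo , hi rewrite ∣tabulate∣-size (F v) = lo , hi

  size-removed : size removed ≡ n
  size-removed = trans (sym (∣∣-size V')) ∣V'∣≡n

  -- Weighing an independent set against `O`.

  module Obstruction (O I : Fin N → Bool)
    (indep : ∀ u v → I u ≡ true → I v ≡ true → h u v ≡ false)
    (I∩O : ∀ u → I u ≡ true → O u ≡ false)
    (I∩V' : ∀ u → I u ≡ true → removed u ≡ false)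
    (I-low : ∀ u → I u ≡ true → degOff h O u ≤ m) where

    d : Fin N → ℕ
    d = degOff h O

    k D : ℕ
    k = size I
    D = ∑∈ I d

    -- Each neighbour of `u` in `G` lies in `V'`, in `O`, or among the `d u` that remain; the part
    -- in `V'` is at most `n`, which cancels.
    m+1≤∣O∣+d : ∀ u → I u ≡ true → suc m ≤ size O + d u
    m+1≤∣O∣+d u Iu = +-cancelʳ-≤ n _ _ (begin
      suc m + n                        ≤⟨ minDeg u ⟩
      degree G u                       ≡⟨ ∣∣-size (adj G u) ⟩
      size (Vec.lookup (adj G u))      ≤⟨ sum-mono-≤ le ⟩
      sum (λ v → (𝟙 (O v) + 𝟙 (h u v ∧ not (O v))) + 𝟙 (removed v))
        ≡⟨ ∑-distrib-+ (λ v → 𝟙 (O v) + 𝟙 (h u v ∧ not (O v))) _ ⟩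
      sum (λ v → 𝟙 (O v) + 𝟙 (h u v ∧ not (O v))) + size removed
        ≡⟨ cong₂ _+_ (∑-distrib-+ (λ v → 𝟙 (O v)) _) size-removed ⟩
      size O + d u + n                 ∎)
      where
      open ≤-Reasoning
      le : ∀ v → 𝟙 (Vec.lookup (adj G u) v) ≤ (𝟙 (O v) + 𝟙 (h u v ∧ not (O v))) + 𝟙 (removed v)
      le v rewrite adj-sym u v | I∩V' u Iu with Vec.lookup (adj G u) v | O v | removed v
      ... | false | _     | _     = z≤n
      ... | true  | true  | _     = s≤s z≤n
      ... | true  | false | true  = s≤s z≤n
      ... | true  | false | false = s≤s z≤n

    neighbour? : ∀ u → Dec (∃ λ i → I i ≡ true × h i u ≡ true)
    neighbour? u = any? λ i → (I i Bool.≟ true) ×-dec (h i u Bool.≟ true)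

    cut : Fin N → Bool
    cut u = removed u ∨ (O u ∨ does (neighbour? u))

    X : Subset N
    X = Vec.tabulate cut

    -- Neighbours of `I` inside `O` are already paid for by `size O`; the others are counted, with
    -- multiplicity, by `D`.
    ∣X∣≤ : ∣ X ∣ ≤ n + (size O + D)
    ∣X∣≤ = begin
      ∣ X ∣     ≡⟨ ∣tabulate∣-size cut ⟩
      size cut  ≤⟨ sum-mono-≤ le ⟩
      sum (λ u → 𝟙 (removed u) + (𝟙 (O u) + sum λ i → 𝟙 (I i) * 𝟙 (h i u ∧ not (O u))))
        ≡⟨ ∑-distrib-+ (λ u → 𝟙 (removed u)) _ ⟩
      size removed + sum (λ u → 𝟙 (O u) + sum λ i → 𝟙 (I i) * 𝟙 (h i u ∧ not (O u)))
        ≡⟨ cong₂ _+_ size-removed (∑-distrib-+ (λ u → 𝟙 (O u)) _) ⟩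
      n + (size O + sum (λ u → sum λ i → 𝟙 (I i) * 𝟙 (h i u ∧ not (O u))))
        ≡⟨ cong (λ c → n + (size O + c)) (∑-comm λ u i → 𝟙 (I i) * 𝟙 (h i u ∧ not (O u))) ⟩
      n + (size O + sum (λ i → sum λ u → 𝟙 (I i) * 𝟙 (h i u ∧ not (O u))))
        ≡⟨ cong (λ c → n + (size O + c)) (sum-cong-≗ λ i → *-distribˡ-sum (𝟙 (I i)) λ u → 𝟙 (h i u ∧ not (O u))) ⟨
      n + (size O + D) ∎
      where
      open ≤-Reasoning
      near : ∀ u → O u ≡ false → 𝟙 (does (neighbour? u)) ≤ sum λ i → 𝟙 (I i) * 𝟙 (h i u ∧ not (O u))
      near u Ou with neighbour? u
      ... | no _               = z≤n
      ... | yes (i , Ii , hiu) = ≤-trans (≤-reflexive (sym (sum-== i))) (sum-mono-≤ pick)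
        where
        pick : ∀ j → 𝟙 (j == i) ≤ 𝟙 (I j) * 𝟙 (h j u ∧ not (O u))
        pick j with j Fin.≟ i
        ... | no _ = z≤n
        ... | yes refl rewrite Ii | hiu | Ou = ≤-refl
      le : ∀ u → 𝟙 (cut u) ≤ 𝟙 (removed u) + (𝟙 (O u) + sum λ i → 𝟙 (I i) * 𝟙 (h i u ∧ not (O u)))
      le u = ∨-bound (removed u) (O u) (near u)

    -- Independence keeps `u` out of the neighbourhood part of `X`. A neighbour of `u` in `G` is
    -- either removed or still a neighbour in `h`, and `X` contains both kinds.
    I-isolated : ∀ u → I u ≡ true → IsolatedIn G X u
    I-isolated u Iu = u∉X , nbr∈X
      where
      u∉X : u ∉ X
      u∉X u∈X = true≢false (trans (sym (∈-tabulate⁻ cut u∈X))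
        (cong₂ _∨_ (I∩V' u Iu) (cong₂ _∨_ (I∩O u Iu) (dec-false (neighbour? u) λ (i , Ii , hiu) →
          true≢false (trans (sym hiu) (indep i u Ii Iu))))))
      nbr∈X : ∀ v → v ∈ adj G u → v ∈ X
      nbr∈X v v∈ = ∈-tabulate⁺ cut in-cut
        where
        in-cut : cut v ≡ true
        in-cut = ∨-intro (removed v) λ Rv → ∨-intro (O v) λ _ → dec-true (neighbour? v) (u , Iu , huv Rv)
          where
          huv : removed v ≡ false → h u v ≡ true
          huv Rv = trans (h-sym u v) (trans (cong₂ (λ x y → x ∧ (not y ∧ not (removed u))) ([]=⇒lookup v∈) Rv)
                  (cong not (I∩V' u Iu)))

    k≤iso : k ≤ iso G X
    k≤iso = ≤-trans (size-⊆ λ u Iu → isolatedSet-complete G X (I-isolated u Iu))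
                    (≤-reflexive (sym (∣∣-size (isolatedSet G X))))

    -- Distinct vertices of `I` are nonadjacent in `h` and neither is removed, so they are
    -- nonadjacent in `G`. This gives access to the clause of the toughness hypothesis about cuts.
    not-complete : 2 ≤ k → ¬ Complete G
    not-complete 2≤k complete = <⇒≱ 2≤k (size-subsingleton same)
      where
      same : ∀ u v → I u ≡ true → I v ≡ true → u ≡ v
      same u v Iu Iv with u Fin.≟ v
      ... | yes u≡v = u≡v
      ... | no u≢v  = contradiction
        (trans (sym (trans (cong₂ _∧_ ([]=⇒lookup (complete u v u≢v))
                             (cong₂ (λ x y → not x ∧ not y) (I∩V' u Iu) (I∩V' v Iv))) refl))
               (indep u v Iu Iv)) true≢false

    -- Replacing `iso G X` by the smaller `k`, and `∣ X ∣` by its upper bound, only weakens the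
    -- inequality.
    toughness-bound : 2 ≤ k → (suc b * (m + n) + m) * k ≤ suc b * (n + (size O + D))
    toughness-bound 2≤k = begin
      (suc b * (m + n) + m) * k           ≤⟨ *-monoʳ-≤ (suc b * (m + n) + m) k≤iso ⟩
      (suc b * (m + n) + m) * iso G X
        ≤⟨ ratio-bound m n b ∣ X ∣ (iso G X) 2≤iso (proj₂ tough (not-complete 2≤k) X 2≤iso) ⟩
      suc b * ∣ X ∣                       ≤⟨ *-monoʳ-≤ (suc b) ∣X∣≤ ⟩
      suc b * (n + (size O + D))          ∎
      where
      open ≤-Reasoning
      2≤iso : 2 ≤ iso G X
      2≤iso = ≤-trans 2≤k k≤iso

    slack : ℕ
    slack = ∑∈ I λ u → m ∸ d u

    weight : ℕ
    weight = ∑∈ I λ u → suc (d u) * (suc m ∸ d u)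

    D+slack : D + slack ≡ k * m
    D+slack = trans (sym (∑∈-+ I d _)) (trans (∑∈-cong I λ u Iu → m+[n∸m]≡n (I-low u Iu)) (∑∈-const I m))

    weight-suc : ∀ u → I u ≡ true → suc (d u) * (suc m ∸ d u) ≡ suc (d u) * suc (m ∸ d u)
    weight-suc u Iu = cong (suc (d u) *_) (+-∸-assoc 1 (I-low u Iu))

    -- Since `suc (d u) ≤ suc m ≤ suc b`, only the factor `suc m ∸ d u` is left, and it sums to
    -- `slack + k`. This form matches the minimum degree bound and serves for `k ≤ 1`.
    weight≤₁ : weight ≤ (slack + k) * suc b
    weight≤₁ = begin
      weight                                  ≤⟨ ∑∈-mono I le ⟩
      (∑∈ I λ u → (m ∸ d u + 1) * suc b)      ≡⟨ ∑∈-*ʳ I _ (suc b) ⟩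
      (∑∈ I λ u → m ∸ d u + 1) * suc b        ≡⟨ cong (_* suc b) (∑∈-+ I (λ u → m ∸ d u) _) ⟩
      (slack + ∑∈ I λ u → 1) * suc b          ≡⟨ cong (λ c → (slack + c) * suc b) (trans (∑∈-const I 1) (*-identityʳ k)) ⟩
      (slack + k) * suc b                     ∎
      where
      open ≤-Reasoning
      le : ∀ u → I u ≡ true → suc (d u) * (suc m ∸ d u) ≤ (m ∸ d u + 1) * suc b
      le u Iu = begin
        suc (d u) * (suc m ∸ d u)    ≡⟨ weight-suc u Iu ⟩
        suc (d u) * suc (m ∸ d u)    ≤⟨ *-monoˡ-≤ (suc (m ∸ d u)) (≤-trans (s≤s (I-low u Iu)) (<⇒≤ a<b)) ⟩
        suc b * suc (m ∸ d u)        ≡⟨ *-comm (suc b) (suc (m ∸ d u)) ⟩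
        suc (m ∸ d u) * suc b        ≡⟨ cong (_* suc b) (+-comm 1 (m ∸ d u)) ⟩
        (m ∸ d u + 1) * suc b        ∎

    -- Expand `(x + 1)(y + 1) = yx + (x + y + 1)` with `x = d u` and `y = m - d u`: the last summand
    -- is the constant `suc m`, and `x ≤ suc b`. Each vertex costs `suc m` instead of the `suc b` of
    -- the first bound, the saving needed against the toughness bound.
    weight≤₂ : weight ≤ slack * suc b + k * suc m
    weight≤₂ = begin
      weight                                            ≤⟨ ∑∈-mono I le ⟩
      (∑∈ I λ u → (m ∸ d u) * suc b + suc m)            ≡⟨ ∑∈-+ I (λ u → (m ∸ d u) * suc b) _ ⟩
      (∑∈ I λ u → (m ∸ d u) * suc b) + (∑∈ I λ u → suc m) ≡⟨ cong₂ _+_ (∑∈-*ʳ I _ (suc b)) (∑∈-const I (suc m)) ⟩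
      slack * suc b + k * suc m                         ∎
      where
      open ≤-Reasoning
      expand : ∀ x y → suc x * suc y ≡ y * x + suc (x + y)
      expand = solve-∀
      le : ∀ u → I u ≡ true → suc (d u) * (suc m ∸ d u) ≤ (m ∸ d u) * suc b + suc m
      le u Iu = begin
        suc (d u) * (suc m ∸ d u)                  ≡⟨ weight-suc u Iu ⟩
        suc (d u) * suc (m ∸ d u)                  ≡⟨ expand (d u) (m ∸ d u) ⟩
        (m ∸ d u) * d u + suc (d u + (m ∸ d u))    ≡⟨ cong (λ c → (m ∸ d u) * d u + suc c) (m+[n∸m]≡n (I-low u Iu)) ⟩
        (m ∸ d u) * d u + suc m
          ≤⟨ +-monoˡ-≤ (suc m) (*-monoʳ-≤ (m ∸ d u) (≤-trans (I-low u Iu) (≤-trans (n≤1+n m) (<⇒≤ a<b)))) ⟩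
        (m ∸ d u) * suc b + suc m                  ∎

    -- The minimum degree bound summed over `I`. Adding `D` to both sides removes the truncated
    -- differences, as `D + slack` is `k * m`.
    slack+k≤k∣O∣ : slack + k ≤ k * size O
    slack+k≤k∣O∣ = +-cancelˡ-≤ D _ _ (begin
      D + (slack + k)            ≡⟨ +-assoc D slack k ⟨
      D + slack + k              ≡⟨ cong (_+ k) D+slack ⟩
      k * m + k                  ≡⟨ trans (+-comm (k * m) k) (sym (*-suc k m)) ⟩
      k * suc m                  ≡⟨ ∑∈-const I (suc m) ⟨
      (∑∈ I λ _ → suc m)         ≤⟨ ∑∈-mono I m+1≤∣O∣+d ⟩
      (∑∈ I λ u → size O + d u)  ≡⟨ ∑∈-+ I (λ _ → size O) d ⟩
      (∑∈ I λ _ → size O) + D    ≡⟨ cong (_+ D) (∑∈-const I (size O)) ⟩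
      k * size O + D             ≡⟨ +-comm (k * size O) D ⟩
      D + k * size O             ∎)
      where open ≤-Reasoning

    -- For k ≥ 2 both sides are shifted so that no subtraction occurs; what the
    -- toughness bound misses is made up by k + bn ≤ k · bn, where bn ≥ 2.
    light : weight ≤ size O * suc b
    light with 2 ≤? k
    -- With at most one vertex, `k * size O ≤ size O`, and the minimum degree suffices.
    ... | no k≱2 = begin
      weight                ≤⟨ weight≤₁ ⟩
      (slack + k) * suc b   ≤⟨ *-monoˡ-≤ (suc b) slack+k≤k∣O∣ ⟩
      k * size O * suc b    ≤⟨ *-monoˡ-≤ (suc b) (*-monoˡ-≤ (size O) (<⇒≤pred (≰⇒> k≱2))) ⟩
      1 * size O * suc b    ≡⟨ cong (_* suc b) (*-identityˡ (size O)) ⟩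
      size O * suc b        ∎
      where open ≤-Reasoning
    ... | yes 2≤k = +-cancelʳ-≤ (suc b * (n + D) + k * (suc b * n)) _ _ (begin
      weight + (suc b * (n + D) + k * (suc b * n))
        ≤⟨ +-monoˡ-≤ _ weight≤₂ ⟩
      slack * suc b + k * suc m + (suc b * (n + D) + k * (suc b * n))
        ≡⟨ rearrange₁ slack (suc b) k m n D ⟩
      (D + slack) * suc b + k * m + k * (suc b * n) + (k + suc b * n)
        ≡⟨ cong (λ c → c * suc b + k * m + k * (suc b * n) + (k + suc b * n)) D+slack ⟩
      k * m * suc b + k * m + k * (suc b * n) + (k + suc b * n)
        ≡⟨ cong (_+ (k + suc b * n)) (rearrange₂ k m (suc b) n) ⟩
      (suc b * (m + n) + m) * k + (k + suc b * n)
        ≤⟨ +-mono-≤ (toughness-bound 2≤k) (k+c≤kc 2≤k 2≤bn) ⟩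
      suc b * (n + (size O + D)) + k * (suc b * n)
        ≡⟨ rearrange₃ (suc b) n (size O) D k ⟩
      size O * suc b + (suc b * (n + D) + k * (suc b * n)) ∎)
      where
      open ≤-Reasoning
      rearrange₁ : ∀ s b k m n D → s * b + k * suc m + (b * (n + D) + k * (b * n)) ≡
        (D + s) * b + k * m + k * (b * n) + (k + b * n)
      rearrange₁ = solve-∀
      rearrange₂ : ∀ k m b n → k * m * b + k * m + k * (b * n) ≡ (b * (m + n) + m) * k
      rearrange₂ = solve-∀
      rearrange₃ : ∀ b n o D k → b * (n + (o + D)) + k * (b * n) ≡ o * b + (b * (n + D) + k * (b * n))
      rearrange₃ = solve-∀
      2≤bn : 2 ≤ suc b * n
      -- The factor `suc b` is at least 2 because it exceeds `suc m`.
      2≤bn = *-mono-≤ (≤-trans (s≤s (s≤s z≤n)) a<b) 1≤n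
      k+c≤kc : ∀ {k c} → 2 ≤ k → 2 ≤ c → k + c ≤ k * c
      k+c≤kc {suc (suc k)} {suc (suc c)} (s≤s (s≤s _)) (s≤s (s≤s _)) = ≤-trans (m≤m+n _ (k * c + (k + c))) (≤-reflexive (expand k c))
        where
        expand : ∀ k c → (2 + k) + (2 + c) + (k * c + (k + c)) ≡ (2 + k) * (2 + c)
        expand = solve-∀

  -- A vertex asks for more than its degree only if it is kept and has `d ≤ m`; the missing amount
  -- is then `suc m ∸ d`.
  deficit-bound : ∀ e r d → 𝟙 e * (if r then 0 else suc m) ≤
    𝟙 e * d + 𝟙 (e ∧ (not r ∧ does (d ≤? m))) * (suc m ∸ d)
  deficit-bound false r    d = z≤n
  deficit-bound true  true d = z≤n
  deficit-bound true  false d with d ≤? m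
  ... | yes d≤m rewrite dec-true (d ≤? m) d≤m = begin
    1 * suc m                    ≡⟨ *-identityˡ (suc m) ⟩
    suc m                        ≤⟨ m≤n+m∸n (suc m) d ⟩
    d + (suc m ∸ d)              ≡⟨ cong₂ _+_ (*-identityˡ d) (*-identityˡ (suc m ∸ d)) ⟨
    1 * d + 1 * (suc m ∸ d)      ∎
    where open ≤-Reasoning
  ... | no d≰m = ≤-trans (*-monoʳ-≤ 1 (≰⇒> d≰m)) (m≤m+n (1 * d) _)

  -- After cancelling the degrees over `E`, a deficient pair would make `size O * suc b` smaller
  -- than the sum of `suc m ∸ degOff h O v` over `T`. The greedy cover bounds that sum by the
  -- `weight` of an independent subset of `T`, and `light` gives the opposite inequality.
  not-deficient : ∀ O E → ¬ Deficient O E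
  not-deficient O E (disj , deficit) = <⇒≱ deficit (begin
    sum (λ v → 𝟙 (E v) * lower v)
      ≤⟨ sum-mono-≤ (λ v → deficit-bound (E v) (removed v) (degOff h O v)) ⟩
    sum (λ v → 𝟙 (E v) * degOff h O v + 𝟙 (T v) * (suc m ∸ degOff h O v))
      ≡⟨ ∑-distrib-+ (λ v → 𝟙 (E v) * degOff h O v) _ ⟩
    ∑∈ E (degOff h O) + (∑∈ T λ v → suc m ∸ degOff h O v)
      ≤⟨ +-monoʳ-≤ (∑∈ E (degOff h O)) cover ⟩
    ∑∈ E (degOff h O) + size O * suc b
      ≡⟨ +-comm (∑∈ E (degOff h O)) _ ⟩
    size O * suc b + ∑∈ E (degOff h O)
      ≡⟨ cong (_+ ∑∈ E (degOff h O)) (∑∈-const O (suc b)) ⟨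
    ∑∈ O (λ _ → suc b) + ∑∈ E (degOff h O) ∎)
    where
    open ≤-Reasoning
    T : Fin N → Bool
    T u = E u ∧ (not (removed u) ∧ does (degOff h O u ≤? m))
    T-disj : ∀ u → O u ≡ true → T u ≡ false
    T-disj u Ou rewrite disj u Ou = refl
    cover : ∑∈ T (λ v → suc m ∸ degOff h O v) ≤ size O * suc b
    -- The weight falls as the degree grows, as the greedy choice requires.
    cover with Greedy.greedy h h-sym h-irrefl O (λ u → suc m ∸ degOff h O u)
                 (λ u v → ∸-monoʳ-≤ (suc m)) (suc (size T)) T ≤-refl T-disj
    ... | I , I⊆T , indep , bound = ≤-trans bound (Obstruction.light O I indep I∩O I∩V' I-low)
      where
      T-kept : ∀ u → I u ≡ true → not (removed u) ≡ true × does (degOff h O u ≤? m) ≡ true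
      T-kept u Iu = ∧-true (not (removed u)) (proj₂ (∧-true (E u) (I⊆T u Iu)))
      I∩O : ∀ u → I u ≡ true → O u ≡ false
      I∩O u Iu = ¬-not {y = true} λ Ou → true≢false (trans (sym (I⊆T u Iu)) (T-disj u Ou))
      I∩V' : ∀ u → I u ≡ true → removed u ≡ false
      I∩V' u Iu = ¬-not {y = true} λ r → true≢false (trans (sym (proj₁ (T-kept u Iu))) (cong not r))
      I-low : ∀ u → I u ≡ true → degOff h O u ≤ m
      I-low u Iu = ≤ᵇ⇒≤ (degOff h O u) m (Equivalence.from T-≡ (proj₂ (T-kept u Iu)))

theorem4 : (a b n : ℕ) → 1 ≤ a → a < b → 1 ≤ n →
    {N : ℕ} (G : Graph N) →
    MinDegreeAtLeast G (a + n) →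
    .{{_ : NonZero b}} →
    IsolToughnessAtLeast G ((+ (a ∸ 1 + n) / 1) +ℚ (+ (a ∸ 1) / b)) →
    (V' : Subset N) → ∣ V' ∣ ≡ n →
    HasFactorOfDeletion G V' a b
-- `1 ≤ a < b` excludes zero for both; with `a = suc m`, the term `a ∸ 1` computes to `m`.
theorem4 (suc m) (suc b) n 1≤a a<b 1≤n G minDeg tough V' ∣V'∣≡n =
  [ Factor⇒HasFactor , (λ (O , E , def) → contradiction def (not-deficient O E)) ]′ factor-or-deficient
  where
  open Deletion a<b 1≤n G minDeg tough V' ∣V'∣≡n
  open Factor h h-sym h-irrefl lower (λ _ → suc b) lower<upper using (factor-or-deficient)
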